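{- Let $n\ge4$. The set $\mathbb{CPI}^n_S$ of closed path independent graphs in $\mathbb G^n_S$ is an $n$-dimensional linear subspace of $\mathbb G^n_S\cong\mathbb R^{\binom n2}$, and $\{\mathbf B^n_j\}_{j=1}^n$ is a basis of it, where $\mathbf B^n_j$ is the vector with $d_{j,k}=1$ for all $k\ne j$ and all other entries $0$.
   Context: $\mathbb G^n_S$ is the space of complete undirected weighted graphs without loops on $V_1,\dots,V_n$ with edge weights $d_{i,j}=d_{j,i}$, identified with $\mathbb R^{\binom n2}$ via the entries $d_{i,j}$, $i<j$. A closed path through a set $D$ ($|D|\ge3$) is a closed path visiting each $V_j$, $j\in D$, exactly once and no other vertex; its length is the sum of its edge weights. A graph is closed path independent iff for every such $D$ all closed paths through $D$ have the same length. -}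

module Defs where

open import Algebra.Bundles using (CommutativeRing)
open import Algebra.Module.Bundles using (Module)
open import Data.Bool.Base using (if_then_else_; _∨_)
open import Data.Fin.Base as Fin using (Fin; zero; suc)
import Data.Fin.Properties as Fin
open import Data.Fin.Subset using (Subset; _∈_; ∣_∣)
open import Data.List.Base using (List; []; _∷_)
import Data.List.Membership.Propositional as List
open import Data.List.Relation.Unary.Unique.Propositional using (Unique)
open import Data.Nat.Base as ℕ using (ℕ; zero; suc)
import Data.Nat.Properties as ℕ
open import Data.Nat.Combinatorics using (_C_; nC1≡n; nCk+nC[k+1]≡[n+1]C[k+1])
open import Data.Product.Base using (Σ; _×_; _,_; ∃-syntax)
open import Data.Rational.Base as ℚ using (ℚ; 0ℚ; 1ℚ; ½)
import Data.Rational.Properties as ℚ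
open import Data.Rational.Solver using (module +-*-Solver)
open import Data.Sum.Base using (_⊎_; inj₁; inj₂)
open import Data.Sum.Function.Propositional using (_⊎-↔_)
open import Function.Bundles using (_⇔_; _↔_; mk↔ₛ′)
open import Function.Construct.Composition using (_↔-∘_)
open import Function.Construct.Identity using (↔-id)
open import Function.Construct.Symmetry using (↔-sym)
open import Level using (0ℓ; _⊔_)
open import Relation.Binary.Definitions using (tri<; tri≈; tri>)
open import Relation.Binary.PropositionalEquality using (_≡_; refl; sym; trans; cong; subst; subst₂)
open import Relation.Nullary.Decidable using (does)
open import Relation.Unary using (Pred)

-- The real numbers are Cauchy sequences of rationals; since quotients are not
-- available, real equality is the relation _≃_ (the difference is null).

Cauchy : (ℕ → ℚ) → Set
Cauchy x = ∀ ε → 0ℚ ℚ.< ε →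
  ∃[ N ] (∀ m n → N ℕ.≤ m → N ℕ.≤ n → ℚ.∣ x m ℚ.- x n ∣ ℚ.< ε)

record ℝ : Set where
  constructor mkℝ
  field
    seq    : ℕ → ℚ
    cauchy : Cauchy seq
open ℝ public

infix 4 _≃_

record _≃_ (x y : ℝ) : Set where
  constructor mk≃
  field
    null : ∀ ε → 0ℚ ℚ.< ε →
      ∃[ N ] (∀ n → N ℕ.≤ n → ℚ.∣ seq x n ℚ.- seq y n ∣ ℚ.< ε)
open _≃_ public

private
  open +-*-Solver using (solve; _:=_; _:+_; _:*_; _:-_; :-_)

  ½ε>0 : ∀ {ε} → 0ℚ ℚ.< ε → 0ℚ ℚ.< ½ ℚ.* ε
  ½ε>0 {ε} ε>0 =
    ℚ.positive⁻¹ (½ ℚ.* ε) {{ℚ.pos*pos⇒pos ½ ε {{ℚ.positive ε>0}}}}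

  ½ε+½ε : ∀ ε → ½ ℚ.* ε ℚ.+ ½ ℚ.* ε ≡ ε
  ½ε+½ε ε = trans (sym (ℚ.*-distribʳ-+ ε ½ ½)) (ℚ.*-identityˡ ε)

  ∣p-p∣≡0 : ∀ p → ℚ.∣ p ℚ.- p ∣ ≡ 0ℚ
  ∣p-p∣≡0 p = cong ℚ.∣_∣ (ℚ.+-inverseʳ p)

  ∣p-q∣≡∣q-p∣ : ∀ p q → ℚ.∣ p ℚ.- q ∣ ≡ ℚ.∣ q ℚ.- p ∣
  ∣p-q∣≡∣q-p∣ p q = trans (sym (ℚ.∣-p∣≡∣p∣ (p ℚ.- q)))
    (cong ℚ.∣_∣ (solve 2 (λ p q → :- (p :- q) := q :- p) refl p q))

  sum-bound : ∀ {p q r ε} → r ≡ p ℚ.+ q →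
    ℚ.∣ p ∣ ℚ.< ½ ℚ.* ε → ℚ.∣ q ∣ ℚ.< ½ ℚ.* ε → ℚ.∣ r ∣ ℚ.< ε
  sum-bound {p} {q} {_} {ε} refl p< q< = ℚ.≤-<-trans (ℚ.∣p+q∣≤∣p∣+∣q∣ p q)
    (subst (ℚ.∣ p ∣ ℚ.+ ℚ.∣ q ∣ ℚ.<_) (½ε+½ε ε) (ℚ.+-mono-< p< q<))

  +-split : ∀ a b c d → (a ℚ.+ b) ℚ.- (c ℚ.+ d) ≡ (a ℚ.- c) ℚ.+ (b ℚ.- d)
  +-split = solve 4 (λ a b c d → (a :+ b) :- (c :+ d) := (a :- c) :+ (b :- d)) refl

  *-split : ∀ a b c d → (a ℚ.* b) ℚ.- (c ℚ.* d) ≡ a ℚ.* (b ℚ.- d) ℚ.+ d ℚ.* (a ℚ.- c)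
  *-split = solve 4 (λ a b c d → (a :* b) :- (c :* d) := a :* (b :- d) :+ d :* (a :- c)) refl

  Bounded : (ℕ → ℚ) → Set
  Bounded x = ∃[ K ] (0ℚ ℚ.< K × ∃[ N ] (∀ n → N ℕ.≤ n → ℚ.∣ x n ∣ ℚ.≤ K))

  bounded : ∀ x → Bounded (seq x)
  bounded x with cauchy x 1ℚ (ℚ.positive⁻¹ 1ℚ)
  ... | N , close = K , K>0 , N , bound
    where
    K = 1ℚ ℚ.+ ℚ.∣ seq x N ∣
    K>0 : 0ℚ ℚ.< K
    K>0 = ℚ.+-mono-<-≤ {0ℚ} {1ℚ} {0ℚ} (ℚ.positive⁻¹ 1ℚ) (ℚ.0≤∣p∣ (seq x N))
    bound : ∀ n → N ℕ.≤ n → ℚ.∣ seq x n ∣ ℚ.≤ K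
    bound n N≤n = subst (λ z → ℚ.∣ z ∣ ℚ.≤ K)
      (solve 2 (λ a b → (a :- b) :+ b := a) refl (seq x n) (seq x N))
      (ℚ.≤-trans (ℚ.∣p+q∣≤∣p∣+∣q∣ (seq x n ℚ.- seq x N) (seq x N))
        (ℚ.+-monoˡ-≤ ℚ.∣ seq x N ∣ (ℚ.<⇒≤ (close n N N≤n ℕ.≤-refl))))

  scale : ∀ K ε → 0ℚ ℚ.< K → 0ℚ ℚ.< ε → ∃[ δ ] (0ℚ ℚ.< δ ×
    (∀ p q → ℚ.∣ p ∣ ℚ.≤ K → ℚ.∣ q ∣ ℚ.< δ → ℚ.∣ p ℚ.* q ∣ ℚ.< ε))
  scale K ε K>0 ε>0 = δ , ℚ.positive⁻¹ δ {{δ⁺}} , est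
    where
    instance
      K⁺ : ℚ.Positive K
      K⁺ = ℚ.positive K>0
      K≢0 : ℚ.NonZero K
      K≢0 = ℚ.pos⇒nonZero K
      K⁻¹⁺ : ℚ.Positive (ℚ.1/ K)
      K⁻¹⁺ = ℚ.1/pos⇒pos K
      ε⁺ : ℚ.Positive ε
      ε⁺ = ℚ.positive ε>0
    δ = (ℚ.1/ K) ℚ.* ε
    δ⁺ : ℚ.Positive δ
    δ⁺ = ℚ.pos*pos⇒pos (ℚ.1/ K) ε
    Kδ≡ε : K ℚ.* δ ≡ ε
    Kδ≡ε = trans (sym (ℚ.*-assoc K (ℚ.1/ K) ε))
      (trans (cong (ℚ._* ε) (ℚ.*-inverseʳ K)) (ℚ.*-identityˡ ε))
    est : ∀ p q → ℚ.∣ p ∣ ℚ.≤ K → ℚ.∣ q ∣ ℚ.< δ → ℚ.∣ p ℚ.* q ∣ ℚ.< ε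
    est p q p≤K q<δ = subst₂ ℚ._<_ (sym (ℚ.∣p*q∣≡∣p∣*∣q∣ p q)) Kδ≡ε
      (ℚ.≤-<-trans
        (ℚ.*-monoʳ-≤-nonNeg ℚ.∣ q ∣ {{ℚ.∣-∣-nonNeg q}} p≤K)
        (ℚ.*-monoʳ-<-pos K q<δ))

  ⊔-l : ∀ {a b n} → a ℕ.⊔ b ℕ.≤ n → a ℕ.≤ n
  ⊔-l {a} {b} = ℕ.m⊔n≤o⇒m≤o a b

  ⊔-r : ∀ {a b n} → a ℕ.⊔ b ℕ.≤ n → b ℕ.≤ n
  ⊔-r {a} {b} = ℕ.m⊔n≤o⇒n≤o a b

  neg-dist : ∀ a b → ℚ.∣ (ℚ.- a) ℚ.- (ℚ.- b) ∣ ≡ ℚ.∣ a ℚ.- b ∣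
  neg-dist a b = trans (cong ℚ.∣_∣ (solve 2 (λ a b → (:- a) :- (:- b) := :- (a :- b)) refl a b))
    (ℚ.∣-p∣≡∣p∣ (a ℚ.- b))

  abstract
    cauchy-const : ∀ q → Cauchy (λ _ → q)
    cauchy-const q ε ε>0 = 0 , λ _ _ _ _ → subst (ℚ._< ε) (sym (∣p-p∣≡0 q)) ε>0

    cauchy-+ : ∀ x y → Cauchy (λ n → seq x n ℚ.+ seq y n)
    cauchy-+ x y ε ε>0 with cauchy x (½ ℚ.* ε) (½ε>0 ε>0) | cauchy y (½ ℚ.* ε) (½ε>0 ε>0)
    ... | M , f | N , g = M ℕ.⊔ N , λ m n ≤m ≤n →
      sum-bound (+-split (seq x m) (seq y m) (seq x n) (seq y n))
        (f m n (⊔-l ≤m) (⊔-l ≤n)) (g m n (⊔-r {M} ≤m) (⊔-r {M} ≤n))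

    cauchy-neg : ∀ x → Cauchy (λ n → ℚ.- seq x n)
    cauchy-neg x ε ε>0 with cauchy x ε ε>0
    ... | N , f = N , λ m n ≤m ≤n →
      subst (ℚ._< ε) (sym (neg-dist (seq x m) (seq x n))) (f m n ≤m ≤n)

    cauchy-* : ∀ x y → Cauchy (λ n → seq x n ℚ.* seq y n)
    cauchy-* x y ε ε>0 =
      let K , K>0 , N₁ , bx = bounded x
          L , L>0 , N₂ , by = bounded y
          δ , δ>0 , ex = scale K (½ ℚ.* ε) K>0 (½ε>0 ε>0)
          η , η>0 , ey = scale L (½ ℚ.* ε) L>0 (½ε>0 ε>0)
          N₃ , cy = cauchy y δ δ>0
          N₄ , cx = cauchy x η η>0
      in (N₁ ℕ.⊔ N₂) ℕ.⊔ (N₃ ℕ.⊔ N₄) , λ m n ≤m ≤n →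
        sum-bound (*-split (seq x m) (seq y m) (seq x n) (seq y n))
          (ex (seq x m) (seq y m ℚ.- seq y n) (bx m (⊔-l {N₁} (⊔-l ≤m)))
            (cy m n (⊔-l {N₃} (⊔-r {N₁ ℕ.⊔ N₂} ≤m)) (⊔-l {N₃} (⊔-r {N₁ ℕ.⊔ N₂} ≤n))))
          (ey (seq y n) (seq x m ℚ.- seq x n) (by n (⊔-r {N₁} (⊔-l ≤n)))
            (cx m n (⊔-r {N₃} (⊔-r {N₁ ℕ.⊔ N₂} ≤m)) (⊔-r {N₃} (⊔-r {N₁ ℕ.⊔ N₂} ≤n))))

fromℚ : ℚ → ℝ
fromℚ q = mkℝ (λ _ → q) (cauchy-const q)

0ℝ 1ℝ : ℝ
0ℝ = fromℚ 0ℚ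
1ℝ = fromℚ 1ℚ

infixl 6 _+ℝ_
infixl 7 _*ℝ_
infix  8 -ℝ_

_+ℝ_ _*ℝ_ : ℝ → ℝ → ℝ
x +ℝ y = mkℝ (λ n → seq x n ℚ.+ seq y n) (cauchy-+ x y)
x *ℝ y = mkℝ (λ n → seq x n ℚ.* seq y n) (cauchy-* x y)

-ℝ_ : ℝ → ℝ
-ℝ x = mkℝ (λ n → ℚ.- seq x n) (cauchy-neg x)

pointwise : ∀ {x y} → (∀ n → seq x n ≡ seq y n) → x ≃ y
pointwise {x} {y} eq = mk≃ λ ε ε>0 → 0 , λ n _ →
  subst (ℚ._< ε) (sym (trans (cong (λ z → ℚ.∣ z ℚ.- seq y n ∣) (eq n)) (∣p-p∣≡0 (seq y n)))) ε>0

≃-sym : ∀ {x y} → x ≃ y → y ≃ x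
≃-sym {x} {y} (mk≃ f) = mk≃ λ ε ε>0 → let N , g = f ε ε>0 in
  N , λ n ≤n → subst (ℚ._< ε) (∣p-q∣≡∣q-p∣ (seq x n) (seq y n)) (g n ≤n)

≃-trans : ∀ {x y z} → x ≃ y → y ≃ z → x ≃ z
≃-trans {x} {y} {z} (mk≃ f) (mk≃ g) = mk≃ λ ε ε>0 →
  let M , f′ = f (½ ℚ.* ε) (½ε>0 ε>0)
      N , g′ = g (½ ℚ.* ε) (½ε>0 ε>0)
  in M ℕ.⊔ N , λ n ≤n →
    sum-bound
      (solve 3 (λ a b c → a :- c := (a :- b) :+ (b :- c)) refl (seq x n) (seq y n) (seq z n))
      (f′ n (⊔-l ≤n)) (g′ n (⊔-r {M} ≤n))

+ℝ-cong : ∀ {x x′ y y′} → x ≃ x′ → y ≃ y′ → x +ℝ y ≃ x′ +ℝ y′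
+ℝ-cong {x} {x′} {y} {y′} (mk≃ f) (mk≃ g) = mk≃ λ ε ε>0 →
  let M , f′ = f (½ ℚ.* ε) (½ε>0 ε>0)
      N , g′ = g (½ ℚ.* ε) (½ε>0 ε>0)
  in M ℕ.⊔ N , λ n ≤n →
    sum-bound (+-split (seq x n) (seq y n) (seq x′ n) (seq y′ n))
      (f′ n (⊔-l ≤n)) (g′ n (⊔-r {M} ≤n))

-ℝ-cong : ∀ {x y} → x ≃ y → -ℝ x ≃ -ℝ y
-ℝ-cong {x} {y} (mk≃ f) = mk≃ λ ε ε>0 → let N , g = f ε ε>0 in
  N , λ n ≤n → subst (ℚ._< ε) (sym (neg-dist (seq x n) (seq y n))) (g n ≤n)

*ℝ-cong : ∀ {x x′ y y′} → x ≃ x′ → y ≃ y′ → x *ℝ y ≃ x′ *ℝ y′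
*ℝ-cong {x} {x′} {y} {y′} (mk≃ f) (mk≃ g) = mk≃ λ ε ε>0 →
  let K , K>0 , N₁ , bx = bounded x
      L , L>0 , N₂ , by = bounded y′
      δ , δ>0 , ex = scale K (½ ℚ.* ε) K>0 (½ε>0 ε>0)
      η , η>0 , ey = scale L (½ ℚ.* ε) L>0 (½ε>0 ε>0)
      N₃ , g′ = g δ δ>0
      N₄ , f′ = f η η>0
  in (N₁ ℕ.⊔ N₂) ℕ.⊔ (N₃ ℕ.⊔ N₄) , λ n ≤n →
    sum-bound (*-split (seq x n) (seq y n) (seq x′ n) (seq y′ n))
      (ex (seq x n) (seq y n ℚ.- seq y′ n) (bx n (⊔-l {N₁} (⊔-l ≤n)))
        (g′ n (⊔-l {N₃} (⊔-r {N₁ ℕ.⊔ N₂} ≤n))))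
      (ey (seq y′ n) (seq x n ℚ.- seq x′ n) (by n (⊔-r {N₁} (⊔-l ≤n)))
        (f′ n (⊔-r {N₃} (⊔-r {N₁ ℕ.⊔ N₂} ≤n))))

ℝ-commutativeRing : CommutativeRing 0ℓ 0ℓ
ℝ-commutativeRing = record
  { Carrier = ℝ
  ; _≈_ = _≃_
  ; _+_ = _+ℝ_
  ; _*_ = _*ℝ_
  ; -_ = -ℝ_
  ; 0# = 0ℝ
  ; 1# = 1ℝ
  ; isCommutativeRing = record
    { isRing = record
      { +-isAbelianGroup = record
        { isGroup = record
          { isMonoid = record
            { isSemigroup = record
              { isMagma = record
                { isEquivalence = record
                  { refl = pointwise λ _ → refl
                  ; sym = ≃-sym
                  ; trans = ≃-trans
                  }
                ; ∙-cong = +ℝ-cong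
                }
              ; assoc = λ x y z → pointwise λ n → ℚ.+-assoc (seq x n) (seq y n) (seq z n)
              }
            ; identity = (λ x → pointwise λ n → ℚ.+-identityˡ (seq x n))
                       , (λ x → pointwise λ n → ℚ.+-identityʳ (seq x n))
            }
          ; inverse = (λ x → pointwise λ n → ℚ.+-inverseˡ (seq x n))
                    , (λ x → pointwise λ n → ℚ.+-inverseʳ (seq x n))
          ; ⁻¹-cong = -ℝ-cong
          }
        ; comm = λ x y → pointwise λ n → ℚ.+-comm (seq x n) (seq y n)
        }
      ; *-cong = *ℝ-cong
      ; *-assoc = λ x y z → pointwise λ n → ℚ.*-assoc (seq x n) (seq y n) (seq z n)
      ; *-identity = (λ x → pointwise λ n → ℚ.*-identityˡ (seq x n))
                   , (λ x → pointwise λ n → ℚ.*-identityʳ (seq x n))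
      ; distrib = (λ x y z → pointwise λ n → ℚ.*-distribˡ-+ (seq x n) (seq y n) (seq z n))
                , (λ x y z → pointwise λ n → ℚ.*-distribʳ-+ (seq x n) (seq y n) (seq z n))
      }
    ; *-comm = λ x y → pointwise λ n → ℚ.*-comm (seq x n) (seq y n)
    }
  }

module _ {r ℓ} (R : CommutativeRing r ℓ) where
  private module R = CommutativeRing R

  functionModule : ∀ {i} (I : Set i) → Module R (i ⊔ r) (i ⊔ ℓ)
  functionModule I = record
    { Carrierᴹ = I → R.Carrier
    ; _≈ᴹ_ = λ u v → ∀ i → u i R.≈ v i
    ; _+ᴹ_ = λ u v i → u i R.+ v i
    ; _*ₗ_ = λ a v i → a R.* v i
    ; _*ᵣ_ = λ v a i → v i R.* a
    ; 0ᴹ = λ _ → R.0#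
    ; -ᴹ_ = λ v i → R.- v i
    ; isModule = record
      { isBimodule = record
        { isBisemimodule = record
          { +ᴹ-isCommutativeMonoid = record
            { isMonoid = record
              { isSemigroup = record
                { isMagma = record
                  { isEquivalence = record
                    { refl = λ _ → R.refl
                    ; sym = λ p i → R.sym (p i)
                    ; trans = λ p q i → R.trans (p i) (q i)
                    }
                  ; ∙-cong = λ p q i → R.+-cong (p i) (q i)
                  }
                ; assoc = λ u v w i → R.+-assoc (u i) (v i) (w i)
                }
              ; identity = (λ u i → R.+-identityˡ (u i)) , (λ u i → R.+-identityʳ (u i))
              }
            ; comm = λ u v i → R.+-comm (u i) (v i)
            }
          ; isPreleftSemimodule = record
            { *ₗ-cong = λ p q i → R.*-cong p (q i)
            ; *ₗ-zeroˡ = λ u i → R.zeroˡ (u i)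
            ; *ₗ-distribʳ = λ u a b i → R.distribʳ (u i) a b
            ; *ₗ-identityˡ = λ u i → R.*-identityˡ (u i)
            ; *ₗ-assoc = λ a b u i → R.*-assoc a b (u i)
            ; *ₗ-zeroʳ = λ a i → R.zeroʳ a
            ; *ₗ-distribˡ = λ a u v i → R.distribˡ a (u i) (v i)
            }
          ; isPrerightSemimodule = record
            { *ᵣ-cong = λ p q i → R.*-cong (p i) q
            ; *ᵣ-zeroʳ = λ u i → R.zeroʳ (u i)
            ; *ᵣ-distribˡ = λ u a b i → R.distribˡ (u i) a b
            ; *ᵣ-identityʳ = λ u i → R.*-identityʳ (u i)
            ; *ᵣ-assoc = λ u a b i → R.*-assoc (u i) a b
            ; *ᵣ-zeroˡ = λ a i → R.zeroˡ a
            ; *ᵣ-distribʳ = λ a u v i → R.distribʳ a (u i) (v i)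
            }
          ; *ₗ-*ᵣ-assoc = λ a u b i → R.*-assoc a (u i) b
          }
        ; -ᴹ‿cong = λ p i → R.-‿cong (p i)
        ; -ᴹ‿inverse = (λ u i → R.-‿inverseˡ (u i)) , (λ u i → R.-‿inverseʳ (u i))
        }
      ; *ₗ-*ᵣ-coincident = λ a u i → R.*-comm a (u i)
      }
    }

module LinearAlgebra {r ℓr m ℓm} {R : CommutativeRing r ℓr} (M : Module R m ℓm) where
  open CommutativeRing R using (Carrier; _≈_; 0#)
  open Module M using (Carrierᴹ; _≈ᴹ_; _+ᴹ_; _*ₗ_; 0ᴹ; +ᴹ-monoid)
  open import Algebra.Properties.Monoid.Sum +ᴹ-monoid using (sum)

  linearCombination : ∀ {k} → (Fin k → Carrier) → (Fin k → Carrierᴹ) → Carrierᴹ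
  linearCombination a b = sum (λ j → a j *ₗ b j)

  record IsLinearSubspace {p} (P : Pred Carrierᴹ p) : Set (r ⊔ m ⊔ ℓm ⊔ p) where
    field
      respects-≈ᴹ : ∀ {u v} → u ≈ᴹ v → P u → P v
      0ᴹ-closed   : P 0ᴹ
      +ᴹ-closed   : ∀ {u v} → P u → P v → P (u +ᴹ v)
      *ₗ-closed   : ∀ a {v} → P v → P (a *ₗ v)

  record IsBasis {p k} (P : Pred Carrierᴹ p) (b : Fin k → Carrierᴹ) : Set (r ⊔ ℓr ⊔ m ⊔ ℓm ⊔ p) where
    field
      member      : ∀ j → P (b j)
      independent : ∀ a → linearCombination a b ≈ᴹ 0ᴹ → ∀ j → a j ≈ 0#
      spanning    : ∀ {v} → P v → ∃[ a ] (v ≈ᴹ linearCombination a b)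

  HasDimension : ∀ {p} → Pred Carrierᴹ p → ℕ → Set (r ⊔ ℓr ⊔ m ⊔ ℓm ⊔ p)
  HasDimension P k = Σ (Fin k → Carrierᴹ) (IsBasis P)

Edge : ℕ → Set
Edge n = Σ (Fin n × Fin n) λ (i , j) → i Fin.< j

𝔾ˢ : ℕ → Module ℝ-commutativeRing 0ℓ 0ℓ
𝔾ˢ n = functionModule ℝ-commutativeRing (Edge n)

Graph : ℕ → Set
Graph n = Module.Carrierᴹ (𝔾ˢ n)

private
  Edge-suc : ∀ n → Edge (suc n) ↔ (Fin n ⊎ Edge n)
  Edge-suc n = mk↔ₛ′ to from to∘from from∘to
    where
    to : Edge (suc n) → Fin n ⊎ Edge n
    to ((zero , suc j) , _)       = inj₁ j
    to ((suc i , suc j) , ℕ.s≤s i<j) = inj₂ ((i , j) , i<j)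
    from : Fin n ⊎ Edge n → Edge (suc n)
    from (inj₁ j)               = (zero , suc j) , ℕ.s≤s ℕ.z≤n
    from (inj₂ ((i , j) , i<j)) = (suc i , suc j) , ℕ.s≤s i<j
    to∘from : ∀ x → to (from x) ≡ x
    to∘from (inj₁ j) = refl
    to∘from (inj₂ e) = refl
    from∘to : ∀ e → from (to e) ≡ e
    from∘to ((zero , suc j) , ℕ.s≤s ℕ.z≤n) = refl
    from∘to ((suc i , suc j) , ℕ.s≤s i<j)  = refl

-- Identifies 𝔾ˢ n, the space of functions Edge n → ℝ, with ℝ^(n choose 2).
Edge↔Fin : ∀ n → Edge n ↔ Fin (n C 2)
Edge↔Fin zero = mk↔ₛ′ (λ { ((() , _) , _) }) (λ ()) (λ ()) (λ { ((() , _) , _) })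
Edge↔Fin (suc n) = subst (λ k → Edge (suc n) ↔ Fin k) count
  (↔-sym (Fin.+↔⊎ {n}) ↔-∘ ((↔-id (Fin n) ⊎-↔ Edge↔Fin n) ↔-∘ Edge-suc n))
  where
  count : n ℕ.+ n C 2 ≡ suc n C 2
  count = trans (cong (ℕ._+ n C 2) (sym (nC1≡n n))) (nCk+nC[k+1]≡[n+1]C[k+1] n 1)

-- The symmetric weight d i j. The value on the diagonal is a placeholder:
-- no closed path through three or more distinct vertices uses it.
d : ∀ {n} → Graph n → Fin n → Fin n → ℝ
d G i j with Fin.<-cmp i j
... | tri< i<j _ _ = G ((i , j) , i<j)
... | tri≈ _ _ _   = 0ℝ
... | tri> _ _ j<i = G ((j , i) , j<i)

-- The closed path start → v₁ → … → vₖ → start, where rest = v₁ ∷ … ∷ vₖ ∷ [].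
record ClosedPath {n} (D : Subset n) : Set where
  field
    start : Fin n
    rest  : List (Fin n)
  vertices : List (Fin n)
  vertices = start ∷ rest
  field
    visitsOnce    : Unique vertices
    visitsExactly : ∀ j → j List.∈ vertices ⇔ j ∈ D

-- The weight of the walk v → ws → s, for ws the intermediate vertices.
walkLength : ∀ {n} → Graph n → (s v : Fin n) → List (Fin n) → ℝ
walkLength G s v []       = d G v s
walkLength G s v (w ∷ ws) = d G v w +ℝ walkLength G s w ws

pathLength : ∀ {n} {D : Subset n} → Graph n → ClosedPath D → ℝ
pathLength G p = walkLength G start start rest
  where open ClosedPath p

ClosedPathIndependent : ∀ {n} → Pred (Graph n) 0ℓ
ClosedPathIndependent {n} G = (D : Subset n) → 3 ℕ.≤ ∣ D ∣ →
  (p q : ClosedPath D) → pathLength G p ≃ pathLength G q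

ℂℙ𝕀ˢ : ∀ n → Pred (Graph n) 0ℓ
ℂℙ𝕀ˢ n = ClosedPathIndependent

𝐁 : ∀ n → Fin n → Graph n
𝐁 n j ((a , b) , _) = if does (a Fin.≟ j) ∨ does (b Fin.≟ j) then 1ℝ else 0ℝ

{-# OPTIONS --safe #-}
-- If the weights have the form d i j = x i + x j, then a closed path through D
-- has length twice the sum of x over D, so the graph is closed path
-- independent; the combination Σ a j · 𝐁 j is the graph of this form with
-- x = a. A three-vertex subgraph recovers x, because
-- 2 x i = d i j + d i k − d j k. Conversely, comparing the closed paths
-- i → j → k → l → i and i → k → j → l → i gives d i j + d k l = d i k + d j l,
-- so d o i + d o j − d i j does not depend on i and j. With c its value,
-- x o = c / 2 and x i = d o i − c / 2 represents the graph.
module Submission where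

open import Defs
open import Algebra.Bundles using (CommutativeRing)
open import Algebra.Module.Bundles using (Module)
open import Data.Bool.Base using (if_then_else_)
open import Data.Fin.Base using (Fin; zero; suc; _<_)
open import Data.Fin.Properties using (_≟_; <-cmp; <-irrelevant; <⇒≢; suc-injective)
open import Data.Fin.Subset using (Subset; ⊥; ⁅_⁆; _∪_; ∣_∣) renaming (_∈_ to _∈ˢ_)
open import Data.Fin.Subset.Properties using (∉⊥; x∈⁅x⁆; x∈⁅y⁆⇒x≡y; x∈p∪q⁻; x∈p∪q⁺; q⊆p∪q; p⊂q⇒∣p∣<∣q∣; p⊆q⇒∣p∣≤∣q∣; ∣⁅x⁆∣≡1)
open import Data.List.Base using (List; []; _∷_; length)
open import Data.List.Membership.Propositional using (_∈_)
open import Data.List.Membership.Propositional.Properties.WithK using (unique∧set⇒bag)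
open import Data.List.Relation.Binary.BagAndSetEquality using (∼bag⇒↭)
open import Data.List.Relation.Binary.Permutation.Propositional using (_↭_; prep; swap; ↭-sym) renaming (refl to ↭-refl; trans to ↭-trans)
open import Data.List.Relation.Binary.Permutation.Propositional.Properties using (∈-resp-↭)
open import Data.List.Relation.Unary.All using (All; []; _∷_; lookup)
open import Data.List.Relation.Unary.AllPairs using ([]; _∷_)
open import Data.List.Relation.Unary.Any using (here; there)
open import Data.List.Relation.Unary.Unique.Propositional using (Unique)
open import Data.Nat.Base using (ℕ; zero; suc; _+_; _≤_; z≤n; s≤s)
open import Data.Nat.Properties using (≤-trans; ≤-reflexive; n≤1+n)
open import Data.Product.Base using (_×_; _,_; ∃-syntax)
open import Data.Rational.Base using (½; 0ℚ)
open import Data.Rational.Solver using (module +-*-Solver)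
open import Data.Sum.Base using (inj₁; inj₂)
open import Function.Base using (_∘_)
open import Function.Bundles using (mk⇔; module Equivalence)
import Function.Construct.Composition as Composition
import Function.Construct.Symmetry as Symmetry
open import Relation.Binary.Definitions using (tri<; tri≈; tri>)
open import Relation.Binary.PropositionalEquality using (_≡_; _≢_; refl; sym; cong; ≢-sym)
open import Relation.Nullary.Decidable using (does; yes; no)
open import Relation.Nullary.Negation using (contradiction)

open +-*-Solver using (solve; con; _:=_; _:+_; _:*_; _:-_)

private
  module R = CommutativeRing ℝ-commutativeRing

open R using (_-_; +-cong; +-congˡ; +-congʳ; *-congˡ; reflexive)
open import Algebra.Properties.CommutativeMonoid.Sum R.+-commutativeMonoid using (sum; sum-cong-≋; sum-replicate-zero; ∑-distrib-+)
open import Relation.Binary.Reasoning.Setoid R.setoid hiding (start)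

-- Edge weights

d-< : ∀ {n} (G : Graph n) {i j} (i<j : i < j) → d G i j ≡ G ((i , j) , i<j)
d-< G {i} {j} i<j with <-cmp i j
... | tri< i<j′ _ _ = cong (λ p → G ((i , j) , p)) (<-irrelevant i<j′ i<j)
... | tri≈ i≮j _ _  = contradiction i<j i≮j
... | tri> i≮j _ _  = contradiction i<j i≮j

d-> : ∀ {n} (G : Graph n) {i j} (j<i : j < i) → d G i j ≡ G ((j , i) , j<i)
d-> G {i} {j} j<i with <-cmp i j
... | tri< _ _ j≮i  = contradiction j<i j≮i
... | tri≈ _ _ j≮i  = contradiction j<i j≮i
... | tri> _ _ j<i′ = cong (λ p → G ((j , i) , p)) (<-irrelevant j<i′ j<i)

d-sym : ∀ {n} (G : Graph n) i j → d G i j ≡ d G j i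
d-sym G i j with <-cmp i j in eq
... | tri< i<j _ _  = sym (d-> G i<j)
-- On the diagonal only the left side has reduced to `0ℝ`; `eq` makes the right side reduce too.
... | tri≈ _ refl _ rewrite eq = refl
... | tri> _ _ j<i  = sym (d-< G j<i)

module _ {n : ℕ} where
  open Module (𝔾ˢ n) using (_≈ᴹ_; _+ᴹ_; _*ₗ_; 0ᴹ)

  d-cong : ∀ {G H : Graph n} → G ≈ᴹ H → ∀ i j → d G i j ≃ d H i j
  d-cong G≈H i j with <-cmp i j
  ... | tri< _ _ _ = G≈H _
  ... | tri≈ _ _ _ = R.refl
  ... | tri> _ _ _ = G≈H _

  d-0 : ∀ i j → d {n} 0ᴹ i j ≡ 0ℝ
  d-0 i j with <-cmp i j
  ... | tri< _ _ _ = refl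
  ... | tri≈ _ _ _ = refl
  ... | tri> _ _ _ = refl

  -- The diagonal placeholder `0ℝ` respects addition as well, so path lengths are additive along
  -- arbitrary walks, with no distinctness of vertices to track.
  d-+ : ∀ (G H : Graph n) i j → d (G +ᴹ H) i j ≃ d G i j +ℝ d H i j
  d-+ G H i j with <-cmp i j
  ... | tri< _ _ _ = R.refl
  ... | tri≈ _ _ _ = R.sym (R.+-identityˡ 0ℝ)
  ... | tri> _ _ _ = R.refl

  d-* : ∀ a (G : Graph n) i j → d (a *ₗ G) i j ≃ a *ℝ d G i j
  d-* a G i j with <-cmp i j
  ... | tri< _ _ _ = R.refl
  ... | tri≈ _ _ _ = R.sym (R.zeroʳ a)
  ... | tri> _ _ _ = R.refl

  -- Path length as a linear function of the graph

  walkLength-cong : ∀ {G H : Graph n} → G ≈ᴹ H → ∀ s v ws → walkLength G s v ws ≃ walkLength H s v ws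
  walkLength-cong G≈H s v []       = d-cong G≈H v s
  walkLength-cong G≈H s v (w ∷ ws) = +-cong (d-cong G≈H v w) (walkLength-cong G≈H s w ws)

  walkLength-0 : ∀ s v ws → walkLength {n} 0ᴹ s v ws ≃ 0ℝ
  walkLength-0 s v []       = reflexive (d-0 v s)
  walkLength-0 s v (w ∷ ws) =
    R.trans (+-cong (reflexive (d-0 v w)) (walkLength-0 s w ws)) (R.+-identityˡ 0ℝ)

  walkLength-+ : ∀ (G H : Graph n) s v ws →
    walkLength (G +ᴹ H) s v ws ≃ walkLength G s v ws +ℝ walkLength H s v ws
  walkLength-+ G H s v []       = d-+ G H v s
  walkLength-+ G H s v (w ∷ ws) = begin
    d (G +ᴹ H) v w +ℝ walkLength (G +ᴹ H) s w ws
      ≈⟨ +-cong (d-+ G H v w) (walkLength-+ G H s w ws) ⟩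
    (d G v w +ℝ d H v w) +ℝ (walkLength G s w ws +ℝ walkLength H s w ws)
      -- Real arithmetic is termwise on sequences, so a ring identity holds exactly at each term and
      -- the rational solver proves it.
      ≈⟨ pointwise (λ m → solve 4 (λ a b c e → (a :+ b) :+ (c :+ e) := (a :+ c) :+ (b :+ e)) refl
           (seq (d G v w) m) (seq (d H v w) m)
           (seq (walkLength G s w ws) m) (seq (walkLength H s w ws) m)) ⟩
    (d G v w +ℝ walkLength G s w ws) +ℝ (d H v w +ℝ walkLength H s w ws) ∎

  walkLength-* : ∀ a (G : Graph n) s v ws → walkLength (a *ₗ G) s v ws ≃ a *ℝ walkLength G s v ws
  walkLength-* a G s v []       = d-* a G v s
  walkLength-* a G s v (w ∷ ws) =
    R.trans (+-cong (d-* a G v w) (walkLength-* a G s w ws))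
      (R.sym (R.distribˡ a (d G v w) (walkLength G s w ws)))

  -- For fixed `D`, `p` and `q` the condition equates two linear functions of the graph, and such
  -- conditions cut out a subspace.
  ℂℙ𝕀ˢ-isLinearSubspace : LinearAlgebra.IsLinearSubspace (𝔾ˢ n) (ℂℙ𝕀ˢ n)
  ℂℙ𝕀ˢ-isLinearSubspace = record
    { respects-≈ᴹ = λ {G} {H} G≈H cpi D 3≤ p q → begin
        pathLength H p ≈⟨ walkLength-cong G≈H (start p) (start p) (rest p) ⟨
        pathLength G p ≈⟨ cpi D 3≤ p q ⟩
        pathLength G q ≈⟨ walkLength-cong G≈H (start q) (start q) (rest q) ⟩
        pathLength H q ∎
    ; 0ᴹ-closed = λ D 3≤ p q → begin
        pathLength 0ᴹ p ≈⟨ walkLength-0 (start p) (start p) (rest p) ⟩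
        0ℝ              ≈⟨ walkLength-0 (start q) (start q) (rest q) ⟨
        pathLength 0ᴹ q ∎
    ; +ᴹ-closed = λ {G} {H} cpiG cpiH D 3≤ p q → begin
        pathLength (G +ᴹ H) p             ≈⟨ walkLength-+ G H (start p) (start p) (rest p) ⟩
        pathLength G p +ℝ pathLength H p  ≈⟨ +-cong (cpiG D 3≤ p q) (cpiH D 3≤ p q) ⟩
        pathLength G q +ℝ pathLength H q  ≈⟨ walkLength-+ G H (start q) (start q) (rest q) ⟨
        pathLength (G +ᴹ H) q             ∎
    ; *ₗ-closed = λ a {G} cpi D 3≤ p q → begin
        pathLength (a *ₗ G) p    ≈⟨ walkLength-* a G (start p) (start p) (rest p) ⟩
        a *ℝ pathLength G p      ≈⟨ *-congˡ (cpi D 3≤ p q) ⟩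
        a *ℝ pathLength G q      ≈⟨ walkLength-* a G (start q) (start q) (rest q) ⟨
        pathLength (a *ₗ G) q    ∎
    }
    where open ClosedPath

-- Graphs with a vertex potential

-- Phrased on edges rather than through `d`, whose diagonal value `0ℝ` need not equal `x i +ℝ x i`.
HasPotential : ∀ {n} → Graph n → (Fin n → ℝ) → Set
HasPotential G x = ∀ {i j} (i<j : i < j) → G ((i , j) , i<j) ≃ x i +ℝ x j

total : ∀ {n} → (Fin n → ℝ) → List (Fin n) → ℝ
total x []       = 0ℝ
total x (v ∷ vs) = x v +ℝ total x vs

total-↭ : ∀ {n} (x : Fin n → ℝ) {vs ws} → vs ↭ ws → total x vs ≃ total x ws
total-↭ x ↭-refl        = R.refl
total-↭ x (prep v p)    = +-congˡ (total-↭ x p)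
total-↭ x (swap {xs} {ys} v w p) = begin
  x v +ℝ (x w +ℝ total x xs) ≈⟨ +-congˡ (+-congˡ (total-↭ x p)) ⟩
  x v +ℝ (x w +ℝ total x ys)
    ≈⟨ pointwise (λ m → solve 3 (λ a b c → a :+ (b :+ c) := b :+ (a :+ c)) refl
         (seq (x v) m) (seq (x w) m) (seq (total x ys) m)) ⟩
  x w +ℝ (x v +ℝ total x ys) ∎
total-↭ x (↭-trans p q) = R.trans (total-↭ x p) (total-↭ x q)

-- Both vertex lists are free of repetitions and have exactly the elements of `D`.
closedPaths-↭ : ∀ {n} {D : Subset n} (p q : ClosedPath D) →
  ClosedPath.vertices p ↭ ClosedPath.vertices q
closedPaths-↭ p q = ∼bag⇒↭ (unique∧set⇒bag (visitsOnce p) (visitsOnce q) λ {j} →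
  Composition.equivalence (visitsExactly p j) (Symmetry.equivalence (visitsExactly q j)))
  where open ClosedPath

module _ {n : ℕ} {G : Graph n} {x : Fin n → ℝ} (pot : HasPotential G x) where

  d-potential : ∀ {i j} → i ≢ j → d G i j ≃ x i +ℝ x j
  d-potential {i} {j} i≢j with <-cmp i j
  ... | tri< i<j _ _ = pot i<j
  ... | tri≈ _ i≡j _ = contradiction i≡j i≢j
  ... | tri> _ _ j<i = R.trans (pot j<i) (R.+-comm (x j) (x i))

  -- Each intermediate vertex lies on two edges of the walk and each end on one. The hypotheses keep
  -- every step off the diagonal.
  walkLength-potential : ∀ s v ws → All (s ≢_) (v ∷ ws) → Unique (v ∷ ws) →
    walkLength G s v ws ≃ x v +ℝ (total x ws +ℝ total x ws +ℝ x s)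
  walkLength-potential s v [] (s≢v ∷ _) _ = R.trans (d-potential (≢-sym s≢v))
    (pointwise λ m → solve 2 (λ a b → a :+ b := a :+ (con 0ℚ :+ con 0ℚ :+ b)) refl
      (seq (x v) m) (seq (x s) m))
  walkLength-potential s v (w ∷ ws) (_ ∷ s∉) ((v≢w ∷ _) ∷ uniq) = begin
    d G v w +ℝ walkLength G s w ws
      ≈⟨ +-cong (d-potential v≢w) (walkLength-potential s w ws s∉ uniq) ⟩
    (x v +ℝ x w) +ℝ (x w +ℝ (total x ws +ℝ total x ws +ℝ x s))
      ≈⟨ pointwise (λ m → solve 4
           (λ a b t c → (a :+ b) :+ (b :+ (t :+ t :+ c)) := a :+ ((b :+ t) :+ (b :+ t) :+ c)) refl
           (seq (x v) m) (seq (x w) m) (seq (total x ws) m) (seq (x s) m)) ⟩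
    x v +ℝ (total x (w ∷ ws) +ℝ total x (w ∷ ws) +ℝ x s) ∎

  -- A walk from `s` back to `s` violates the hypothesis of `walkLength-potential`, so the edge from
  -- `s` to `w` is split off; it brings the second copy of `x s`.
  cycleLength-potential : ∀ s w ws → Unique (s ∷ w ∷ ws) →
    walkLength G s s (w ∷ ws) ≃ total x (s ∷ w ∷ ws) +ℝ total x (s ∷ w ∷ ws)
  cycleLength-potential s w ws (s∉@(s≢w ∷ _) ∷ uniq) = begin
    d G s w +ℝ walkLength G s w ws
      ≈⟨ +-cong (d-potential s≢w) (walkLength-potential s w ws s∉ uniq) ⟩
    (x s +ℝ x w) +ℝ (x w +ℝ (total x ws +ℝ total x ws +ℝ x s))
      ≈⟨ pointwise (λ m → solve 3
           (λ a b t → (a :+ b) :+ (b :+ (t :+ t :+ a)) := (a :+ (b :+ t)) :+ (a :+ (b :+ t))) refl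
           (seq (x s) m) (seq (x w) m) (seq (total x ws) m)) ⟩
    total x (s ∷ w ∷ ws) +ℝ total x (s ∷ w ∷ ws) ∎

  pathLength-potential : ∀ {D} → 2 ≤ ∣ D ∣ → (p : ClosedPath D) → let open ClosedPath p in
    pathLength G p ≃ total x vertices +ℝ total x vertices
  -- A one-vertex path would have the diagonal placeholder as its length; it would force `D` into a
  -- singleton, against the size bound.
  pathLength-potential {D} 2≤ record { start = s ; rest = [] ; visitsExactly = exact } =
    contradiction (≤-trans 2≤ (≤-trans (p⊆q⇒∣p∣≤∣q∣ D⊆s) (≤-reflexive (∣⁅x⁆∣≡1 s)))) λ { (s≤s ()) }
    where
    D⊆s : ∀ {j} → j ∈ˢ D → j ∈ˢ ⁅ s ⁆
    D⊆s {j} j∈D with Equivalence.from (exact j) j∈D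
    ... | here refl = x∈⁅x⁆ s
  pathLength-potential 2≤ record { start = s ; rest = w ∷ ws ; visitsOnce = uniq } =
    cycleLength-potential s w ws uniq

  potential⇒CPI : ClosedPathIndependent G
  potential⇒CPI D 3≤ p q = begin
    pathLength G p                                  ≈⟨ pathLength-potential 2≤ p ⟩
    total x (vertices p) +ℝ total x (vertices p)    ≈⟨ +-cong eq eq ⟩
    total x (vertices q) +ℝ total x (vertices q)    ≈⟨ pathLength-potential 2≤ q ⟨
    pathLength G q                                  ∎
    where
    open ClosedPath
    2≤ = ≤-trans (n≤1+n 2) 3≤
    eq = total-↭ x (closedPaths-↭ p q)

-- Combinations of the basis vectors and uniqueness of potentials

δ : ∀ {n} → Fin n → Fin n → ℝ
δ i j = if does (i ≟ j) then 1ℝ else 0ℝ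

sum-δ : ∀ {n} (a : Fin n → ℝ) i → sum (λ j → a j *ℝ δ i j) ≃ a i
sum-δ {suc n} a zero = begin
  a zero *ℝ 1ℝ +ℝ sum (λ j → a (suc j) *ℝ 0ℝ)
    ≈⟨ +-cong (R.*-identityʳ (a zero)) (sum-cong-≋ {n} (λ j → R.zeroʳ (a (suc j)))) ⟩
  a zero +ℝ sum {n} (λ _ → 0ℝ)  ≈⟨ +-congˡ (sum-replicate-zero n) ⟩
  a zero +ℝ 0ℝ                  ≈⟨ R.+-identityʳ (a zero) ⟩
  a zero                        ∎
sum-δ {suc n} a (suc i) = begin
  a zero *ℝ 0ℝ +ℝ sum (λ j → a (suc j) *ℝ δ i j)
    ≈⟨ +-cong (R.zeroʳ (a zero)) (sum-δ (a ∘ suc) i) ⟩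
  0ℝ +ℝ a (suc i)  ≈⟨ R.+-identityˡ (a (suc i)) ⟩
  a (suc i)        ∎

-- The ends of an edge are distinct, so at most one equals `j`, and the disjunction in `𝐁` is a sum
-- of two indicators.
𝐁-potential : ∀ {n} (j : Fin n) → HasPotential (𝐁 n j) (λ i → δ i j)
𝐁-potential j {i} {k} i<k with i ≟ j | k ≟ j
... | yes refl | yes refl = contradiction refl (<⇒≢ i<k)
... | yes _    | no _     = R.sym (R.+-identityʳ 1ℝ)
... | no _     | yes _    = R.sym (R.+-identityˡ 1ℝ)
... | no _     | no _     = R.sym (R.+-identityˡ 0ℝ)

module _ (n : ℕ) where
  open LinearAlgebra (𝔾ˢ n) using (linearCombination)
  open Module (𝔾ˢ n) using (+ᴹ-monoid; _*ₗ_)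
  open import Algebra.Properties.Monoid.Sum +ᴹ-monoid using () renaming (sum to sumᴹ)

  -- Turns a sum of graphs, read at one edge, into a sum of reals, where the laws for `sum` apply.
  sumᴹ-apply : ∀ {k} (f : Fin k → Graph n) e → sumᴹ f e ≡ sum (λ j → f j e)
  sumᴹ-apply {zero}  f e = refl
  sumᴹ-apply {suc k} f e = cong (f zero e +ℝ_) (sumᴹ-apply (f ∘ suc) e)

  linearCombination-potential : ∀ a → HasPotential (linearCombination a (𝐁 n)) a
  linearCombination-potential a {i} {k} i<k = begin
    linearCombination a (𝐁 n) e                 ≡⟨ sumᴹ-apply (λ j → a j *ₗ 𝐁 n j) e ⟩
    sum (λ j → a j *ℝ 𝐁 n j e)
      ≈⟨ sum-cong-≋ {n} (λ j → R.trans (*-congˡ (𝐁-potential j i<k)) (R.distribˡ (a j) (δ i j) (δ k j))) ⟩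
    sum (λ j → a j *ℝ δ i j +ℝ a j *ℝ δ k j)
      ≈⟨ ∑-distrib-+ (λ j → a j *ℝ δ i j) (λ j → a j *ℝ δ k j) ⟩
    sum (λ j → a j *ℝ δ i j) +ℝ sum (λ j → a j *ℝ δ k j)
      ≈⟨ +-cong (sum-δ a i) (sum-δ a k) ⟩
    a i +ℝ a k ∎
    where e = (i , k) , i<k

two-others : ∀ {n} (i : Fin (3 + n)) → ∃[ j ] ∃[ k ] (i ≢ j × i ≢ k × j ≢ k)
two-others zero          = suc zero , suc (suc zero) , (λ ()) , (λ ()) , (λ ())
two-others (suc zero)    = zero , suc (suc zero) , (λ ()) , (λ ()) , (λ ())
two-others (suc (suc i)) = zero , suc zero , (λ ()) , (λ ()) , (λ ())

-- In the triangle on `i`, `j`, `k` the two edges at `i` minus the opposite edge leave `x i` twice.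
-- Since the right side depends on `G` alone, this yields linear independence.
potential-unique : ∀ {n} {G : Graph n} {x i j k} → HasPotential G x → i ≢ j → i ≢ k → j ≢ k →
  x i ≃ fromℚ ½ *ℝ (d G i j +ℝ d G i k - d G j k)
potential-unique {G = G} {x} {i} {j} {k} pot i≢j i≢k j≢k = begin
  x i
    ≈⟨ pointwise (λ m → solve 3 (λ a b c → a := con ½ :* ((a :+ b) :+ (a :+ c) :- (b :+ c))) refl
         (seq (x i) m) (seq (x j) m) (seq (x k) m)) ⟩
  fromℚ ½ *ℝ ((x i +ℝ x j) +ℝ (x i +ℝ x k) - (x j +ℝ x k))
    ≈⟨ *-congˡ (+-cong (+-cong (d-potential pot i≢j) (d-potential pot i≢k))
         (R.-‿cong (d-potential pot j≢k))) ⟨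
  fromℚ ½ *ℝ (d G i j +ℝ d G i k - d G j k) ∎

-- The four-point condition

fromList : ∀ {n} → List (Fin n) → Subset n
fromList []       = ⊥
fromList (v ∷ vs) = ⁅ v ⁆ ∪ fromList vs

∈-fromList⁺ : ∀ {n} {j : Fin n} {vs} → j ∈ vs → j ∈ˢ fromList vs
∈-fromList⁺ {j = j} (here refl)  = x∈p∪q⁺ (inj₁ (x∈⁅x⁆ j))
∈-fromList⁺ (there j∈vs) = x∈p∪q⁺ (inj₂ (∈-fromList⁺ j∈vs))

∈-fromList⁻ : ∀ {n} {j : Fin n} vs → j ∈ˢ fromList vs → j ∈ vs
∈-fromList⁻ []       j∈ = contradiction j∈ ∉⊥
∈-fromList⁻ (v ∷ vs) j∈ with x∈p∪q⁻ ⁅ v ⁆ (fromList vs) j∈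
... | inj₁ j∈v  = here (x∈⁅y⁆⇒x≡y v j∈v)
... | inj₂ j∈vs = there (∈-fromList⁻ vs j∈vs)

-- Each prepended vertex is new, so the subset grows strictly. This supplies the bound on `∣ D ∣`
-- that `ClosedPathIndependent` asks for.
length≤∣fromList∣ : ∀ {n} {vs : List (Fin n)} → Unique vs → length vs ≤ ∣ fromList vs ∣
length≤∣fromList∣ {vs = []} [] = z≤n
length≤∣fromList∣ {vs = v ∷ vs} (v∉vs ∷ uniq) = ≤-trans (s≤s (length≤∣fromList∣ uniq))
  (p⊂q⇒∣p∣<∣q∣ (q⊆p∪q ⁅ v ⁆ (fromList vs) , v , x∈p∪q⁺ (inj₁ (x∈⁅x⁆ v)) ,
    λ v∈ → lookup v∉vs (∈-fromList⁻ vs v∈) refl))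

-- The permutation lets different orders of the same vertices give paths through one and the same
-- subset `fromList ws`, as a comparison requires.
closedPath : ∀ {n} (s : Fin n) vs {ws} → Unique (s ∷ vs) → s ∷ vs ↭ ws → ClosedPath (fromList ws)
closedPath s vs {ws} uniq p = record
  { start         = s
  ; rest          = vs
  ; visitsOnce    = uniq
  ; visitsExactly = λ j → mk⇔ (∈-fromList⁺ ∘ ∈-resp-↭ p) (∈-resp-↭ (↭-sym p) ∘ ∈-fromList⁻ ws)
  }

-- The two cycles share the edges `j k` and `l i`; subtracting these from the equal lengths leaves
-- the claim.
four-point : ∀ {n} {G : Graph n} → ClosedPathIndependent G →
  ∀ {i j k l} → Unique (i ∷ j ∷ k ∷ l ∷ []) → d G i j +ℝ d G k l ≃ d G i k +ℝ d G j l
four-point {G = G} cpi {i} {j} {k} {l}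
  uniq@((i≢j ∷ i≢k ∷ i≢l ∷ []) ∷ (j≢k ∷ j≢l ∷ []) ∷ (k≢l ∷ []) ∷ [] ∷ []) = begin
  d G i j +ℝ d G k l
    ≈⟨ pointwise (λ m → solve 4 (λ a b c e → a :+ c := (a :+ (b :+ (c :+ e))) :- (b :+ e)) refl
         (seq (d G i j) m) (seq (d G j k) m) (seq (d G k l) m) (seq (d G l i) m)) ⟩
  (d G i j +ℝ (d G j k +ℝ (d G k l +ℝ d G l i))) - (d G j k +ℝ d G l i)
    ≈⟨ +-congʳ (cpi _ (≤-trans (n≤1+n 3) (length≤∣fromList∣ uniq))
         (closedPath i (j ∷ k ∷ l ∷ []) uniq ↭-refl)
         (closedPath i (k ∷ j ∷ l ∷ []) uniq′ (prep i (swap k j ↭-refl)))) ⟩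
  (d G i k +ℝ (d G k j +ℝ (d G j l +ℝ d G l i))) - (d G j k +ℝ d G l i)
    ≡⟨ cong (λ y → (d G i k +ℝ (y +ℝ (d G j l +ℝ d G l i))) - (d G j k +ℝ d G l i)) (d-sym G k j) ⟩
  (d G i k +ℝ (d G j k +ℝ (d G j l +ℝ d G l i))) - (d G j k +ℝ d G l i)
    ≈⟨ pointwise (λ m → solve 4 (λ a b c e → (a :+ (b :+ (c :+ e))) :- (b :+ e) := a :+ c) refl
         (seq (d G i k) m) (seq (d G j k) m) (seq (d G j l) m) (seq (d G l i) m)) ⟩
  d G i k +ℝ d G j l ∎
  where
  uniq′ : Unique (i ∷ k ∷ j ∷ l ∷ [])
  uniq′ = (i≢k ∷ i≢j ∷ i≢l ∷ []) ∷ (≢-sym j≢k ∷ k≢l ∷ []) ∷ (j≢l ∷ []) ∷ [] ∷ []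

-- Constancy of the excess and construction of a potential

module _ {n : ℕ} {G : Graph (suc n)} (cpi : ClosedPathIndependent G) where

  -- Twice the Gromov product of suc i and suc j at the base point zero.
  excess : Fin n → Fin n → ℝ
  excess i j = d G zero (suc i) +ℝ d G zero (suc j) - d G (suc i) (suc j)

  excess-comm : ∀ i j → excess i j ≃ excess j i
  excess-comm i j = +-cong (R.+-comm _ _) (R.-‿cong (reflexive (d-sym G (suc i) (suc j))))

  -- This is `four-point` at the base point, `i`, `k`, `j`, rearranged. It needs four distinct
  -- vertices, so `i` equal to `k` is treated apart.
  excess-exchange : ∀ {i j k} → i ≢ j → k ≢ j → excess i j ≃ excess k j
  excess-exchange {i} {j} {k} i≢j k≢j with i ≟ k
  ... | yes refl = R.refl
  ... | no i≢k = begin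
    (oi +ℝ oj) - ij
      ≈⟨ pointwise (λ m → solve 4 (λ a b c e → a :+ b :- c := (a :+ e) :+ (b :- c :- e)) refl
           (seq oi m) (seq oj m) (seq ij m) (seq kj m)) ⟩
    (oi +ℝ kj) +ℝ (oj - ij - kj)
      ≈⟨ +-congʳ (four-point cpi {zero}
           (((λ ()) ∷ (λ ()) ∷ (λ ()) ∷ []) ∷
            (i≢k ∘ suc-injective ∷ i≢j ∘ suc-injective ∷ []) ∷
            (k≢j ∘ suc-injective ∷ []) ∷ [] ∷ [])) ⟩
    (ok +ℝ ij) +ℝ (oj - ij - kj)
      ≈⟨ pointwise (λ m → solve 4 (λ a b c e → (a :+ c) :+ (b :- c :- e) := a :+ b :- e) refl
           (seq ok m) (seq oj m) (seq ij m) (seq kj m)) ⟩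
    (ok +ℝ oj) - kj ∎
    where
    oi = d G zero (suc i)
    oj = d G zero (suc j)
    ok = d G zero (suc k)
    ij = d G (suc i) (suc j)
    kj = d G (suc k) (suc j)

  -- Replaces one index at a time, using symmetry to bring it into first place.
  excess-constant : ∀ {i j k l} → i ≢ j → k ≢ l → excess i j ≃ excess k l
  excess-constant {i} {j} {k} {l} i≢j k≢l with j ≟ k
  -- The route of the other case would pass through the diagonal `excess k j`; here `i` is replaced
  -- by `l` directly.
  ... | yes refl = begin
    excess i j ≈⟨ excess-exchange i≢j (≢-sym k≢l) ⟩
    excess l j ≈⟨ excess-comm l j ⟩
    excess j l ∎
  ... | no j≢k = begin
    excess i j ≈⟨ excess-exchange i≢j (≢-sym j≢k) ⟩
    excess k j ≈⟨ excess-comm k j ⟩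
    excess j k ≈⟨ excess-exchange j≢k (≢-sym k≢l) ⟩
    excess l k ≈⟨ excess-comm l k ⟩
    excess k l ∎

CPI⇒potential : ∀ {n} {G : Graph (3 + n)} → ClosedPathIndependent G →
  ∃[ x ] HasPotential G x
CPI⇒potential {n} {G} cpi = x , pot
  where
  c = excess cpi zero (suc zero)

  x : Fin (3 + n) → ℝ
  -- Forced: by `potential-unique` at `zero` the value is half the excess, and the edges at `zero`
  -- then determine all other values.
  x zero    = fromℚ ½ *ℝ c
  x (suc i) = d G zero (suc i) - fromℚ ½ *ℝ c

  pot : HasPotential G x
  pot {zero} {suc j} i<j = begin
    G ((zero , suc j) , i<j)   ≡⟨ d-< G i<j ⟨
    d G zero (suc j)
      ≈⟨ pointwise (λ m → solve 2 (λ a h → a := h :+ (a :- h)) refl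
           (seq (d G zero (suc j)) m) (seq (fromℚ ½ *ℝ c) m)) ⟩
    x zero +ℝ x (suc j) ∎
  pot {suc i} {suc j} i<j = begin
    G ((suc i , suc j) , i<j)   ≡⟨ d-< G i<j ⟨
    ij
      ≈⟨ pointwise (λ m → solve 3 (λ a b e → e := a :+ b :- (a :+ b :- e)) refl
           (seq oi m) (seq oj m) (seq ij m)) ⟩
    oi +ℝ oj - excess cpi i j
      ≈⟨ +-congˡ (R.-‿cong (excess-constant cpi (<⇒≢ i<j ∘ cong suc) (λ ()))) ⟩
    oi +ℝ oj - c
      ≈⟨ pointwise (λ m → solve 3 (λ a b e → a :+ b :- e := (a :- con ½ :* e) :+ (b :- con ½ :* e)) refl
           (seq oi m) (seq oj m) (seq c m)) ⟩
    x (suc i) +ℝ x (suc j) ∎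
    where
    oi = d G zero (suc i)
    oj = d G zero (suc j)
    ij = d G (suc i) (suc j)

-- The basis and the dimension

𝐁-isBasis : ∀ n → LinearAlgebra.IsBasis (𝔾ˢ (3 + n)) (ℂℙ𝕀ˢ (3 + n)) (𝐁 (3 + n))
𝐁-isBasis n = record
  { member      = λ j → potential⇒CPI (𝐁-potential j)
  ; independent = independent
  -- A potential serves as the coefficient vector: the graph and the combination both have it, so
  -- they agree on every edge.
  ; spanning    = λ cpi → let x , pot = CPI⇒potential cpi in
      x , λ (_ , i<j) → R.trans (pot i<j) (R.sym (linearCombination-potential N x i<j))
  }
  where
  N = 3 + n
  open LinearAlgebra (𝔾ˢ N) using (linearCombination)
  open Module (𝔾ˢ N) using (_≈ᴹ_; 0ᴹ)

  independent : ∀ a → linearCombination a (𝐁 N) ≈ᴹ 0ᴹ → ∀ i → a i ≃ 0ℝ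
  -- The coefficients are the potential of the combination, so each can be read off a triangle, all
  -- of whose weights vanish here.
  independent a L≈0 i = let j , k , i≢j , i≢k , j≢k = two-others i in begin
    a i
      ≈⟨ potential-unique (linearCombination-potential N a) i≢j i≢k j≢k ⟩
    fromℚ ½ *ℝ (d L i j +ℝ d L i k - d L j k)
      ≈⟨ *-congˡ (+-cong (+-cong (dL≈0 i j) (dL≈0 i k)) (R.-‿cong (dL≈0 j k))) ⟩
    fromℚ ½ *ℝ (0ℝ +ℝ 0ℝ - 0ℝ)
      ≈⟨ pointwise (λ _ → refl) ⟩
    0ℝ ∎
    where
    L = linearCombination a (𝐁 N)
    dL≈0 : ∀ i j → d L i j ≃ 0ℝ
    dL≈0 i j = R.trans (d-cong L≈0 i j) (reflexive (d-0 i j))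

theorem9 : (n : ℕ) → 4 ≤ n →
    LinearAlgebra.IsLinearSubspace (𝔾ˢ n) (ℂℙ𝕀ˢ n)
    × LinearAlgebra.HasDimension (𝔾ˢ n) (ℂℙ𝕀ˢ n) n
    × LinearAlgebra.IsBasis (𝔾ˢ n) (ℂℙ𝕀ˢ n) (𝐁 n)
theorem9 n@(suc (suc (suc m))) _ = ℂℙ𝕀ˢ-isLinearSubspace , (𝐁 n , 𝐁-isBasis m) , 𝐁-isBasis m
theorem9 (suc (suc zero)) (s≤s (s≤s ()))
theorem9 (suc zero) (s≤s ())
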